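{- Let $d\ge 1$ and $t\ge 1$ be integers and let $H$ be a nonempty connected simple graph with the path metric. Then the following are equivalent: (i) for every $A\subset\mathbb{Z}^d$, every $t$-Lipschitz map $f:A\to H$ has a $t$-Lipschitz extension $\mathbb{Z}^d\to H$; (ii) for all (not necessarily distinct) balls $B_1,B_2,\dots,B_{2d}$ in $H$ whose radii are integer multiples of $t$, if the balls pairwise intersect, i.e. $B_i\cap B_j\ne\varnothing$ for all $1\le i,j\le 2d$, then $\bigcap_{i=1}^{2d}B_i\neq\varnothing$.
   Context: A graph is identified with its vertex set, viewed as a metric space with the path metric; graphs may be infinite. $\mathbb{Z}^d$ denotes the Cayley graph of the group $\mathbb{Z}^d$ with respect to the standard generators (path metric $=\ell_1$ metric), and subsets $A\subset\mathbb{Z}^d$ carry the restricted metric. A map $f$ is $t$-Lipschitz if $d_H(f(a),f(a'))\le t\, d(a,a')$ for all $a,a'$. Balls are closed balls $\{w: d_H(v,w)\le r\}$ with $r\ge 0$. -}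

module Defs where

open import Axiom.ExcludedMiddle using (ExcludedMiddle)
open import Data.Fin.Base using (Fin; zero; suc)
open import Data.Integer.Base as ℤ using (ℤ; +_; -[1+_])
import Data.Integer.Properties as ℤ
open import Data.Integer.Tactic.RingSolver using (solve-∀)
open import Data.Nat.Base using (ℕ; _+_; _*_; _≤_; _<_; z≤n)
open import Data.Nat.Divisibility using (_∣_)
open import Data.Nat.Induction using (<-wellFounded; Acc; acc)
open import Data.Nat.Properties using (≤-trans; ≤-reflexive; +-monoˡ-≤; +-monoʳ-≤; +-suc; ≮⇒≥)
open import Data.Product.Base using (Σ; ∃-syntax; _×_; _,_; proj₁; proj₂)
open import Data.Sum.Base using (_⊎_; inj₁; inj₂)
open import Data.Vec.Base using (Vec; []; _∷_; lookup; _[_]%=_)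
import Data.Vec.Properties as Vec
open import Function.Base using (_on_)
open import Level using (Level; 0ℓ)
open import Relation.Binary.Construct.Closure.ReflexiveTransitive using (Star; ε; _◅_; _◅◅_; fold)
open import Relation.Binary.PropositionalEquality using (_≡_; _≢_; refl; sym; trans; cong; cong₂; subst)
open import Relation.Nullary.Decidable.Core using (yes; no)
open import Relation.Nullary.Negation.Core using (¬_)
open import Relation.Unary using (Pred; _≬_; Satisfiable; ⋂)

private
  variable
    ℓ : Level

record SimpleGraph (ℓ : Level) : Set (Level.suc ℓ) where
  field
    Vertex   : Set ℓ
    _~_      : Vertex → Vertex → Set ℓ
    ~-sym    : ∀ {u v} → u ~ v → v ~ u
    ~-irrefl : ∀ {u} → ¬ (u ~ u)

  Walk : Vertex → Vertex → Set ℓ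
  Walk = Star _~_

  len : ∀ {u v} → Walk u v → ℕ
  len = fold (λ _ _ → ℕ) (λ _ n → ℕ.suc n) 0

open SimpleGraph public using (Vertex)

Connected : SimpleGraph ℓ → Set ℓ
Connected G = ∀ u v → SimpleGraph.Walk G u v

IsPathMetric : (G : SimpleGraph ℓ) → (Vertex G → Vertex G → ℕ) → Set ℓ
IsPathMetric G δ =
  ∀ u v → (∃[ w ] len {u} {v} w ≡ δ u v) × (∀ (w : Walk u v) → δ u v ≤ len w)
  where open SimpleGraph G

-- Excluded middle is used to find a shortest walk: adjacency in an arbitrary
-- graph is not decidable.
module _ (em : ExcludedMiddle ℓ) (G : SimpleGraph ℓ) where
  open SimpleGraph G

  shortest : ∀ {u v} (w : Walk u v) → Acc _<_ (len w) →
             Σ (Walk u v) λ s → ∀ w′ → len s ≤ len w′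
  shortest {u} {v} w (acc rs) with em {Σ (Walk u v) λ w′ → len w′ < len w}
  ... | yes (w′ , w′<w) = shortest w′ (rs w′<w)
  ... | no ¬shorter     = w , λ w′ → ≮⇒≥ λ w′<w → ¬shorter (w′ , w′<w)

  dist : Connected G → Vertex G → Vertex G → ℕ
  dist conn u v = len (proj₁ (shortest (conn u v) (<-wellFounded _)))

  dist-isPathMetric : (conn : Connected G) → IsPathMetric G (dist conn)
  dist-isPathMetric conn u v = (proj₁ s , refl) , proj₂ s
    where s = shortest (conn u v) (<-wellFounded _)

ℤ^_ : ℕ → Set
ℤ^ d = Vec ℤ d

ℓ₁ : ∀ {d} → ℤ^ d → ℤ^ d → ℕ
ℓ₁ []       []       = 0
ℓ₁ (x ∷ xs) (y ∷ ys) = ℤ.∣ x ℤ.- y ∣ + ℓ₁ xs ys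

Adjacent : ∀ {d} → ℤ^ d → ℤ^ d → Set
Adjacent x y = ∃[ i ] (y ≡ x [ i ]%= ℤ.suc ⊎ y ≡ x [ i ]%= ℤ.pred)

cayley : ℕ → SimpleGraph 0ℓ
cayley d = record
  { Vertex   = ℤ^ d
  ; _~_      = Adjacent
  ; ~-sym    = symm
  ; ~-irrefl = irrefl
  }
  where
  symm : ∀ {x y : ℤ^ d} → Adjacent x y → Adjacent y x
  symm {x} (i , inj₁ refl) = i , inj₂ (sym (trans (Vec.updateAt-updateAt i x)
    (Vec.updateAt-id-local i x (ℤ.pred-suc _))))
  symm {x} (i , inj₂ refl) = i , inj₁ (sym (trans (Vec.updateAt-updateAt i x)
    (Vec.updateAt-id-local i x (ℤ.suc-pred _))))

  at : ∀ {n} (i : Fin n) (x : Vec ℤ n) {f : ℤ → ℤ} →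
       x ≡ x [ i ]%= f → lookup x i ≡ f (lookup x i)
  at i x eq = trans (cong (λ y → lookup y i) eq) (Vec.lookup∘updateAt i x)

  i≢pred[i] : ∀ {z} → z ≢ ℤ.pred z
  i≢pred[i] {z} eq =
    ℤ.i≢suc[i] (sym (trans (cong ℤ.suc eq) (ℤ.suc-pred z)))

  irrefl : ∀ {x : ℤ^ d} → ¬ Adjacent x x
  irrefl {x} (i , inj₁ eq) = ℤ.i≢suc[i] (at i x eq)
  irrefl {x} (i , inj₂ eq) = i≢pred[i] (at i x eq)

-- The path metric of the Cayley graph of ℤᵈ is the ℓ₁ metric.
ℓ₁-isPathMetric : ∀ d → IsPathMetric (cayley d) ℓ₁
ℓ₁-isPathMetric _ x y = reach x y , lower
  where
  Walk : ∀ {d} → ℤ^ d → ℤ^ d → Set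
  Walk {d} = SimpleGraph.Walk (cayley d)

  len : ∀ {d} {x y : ℤ^ d} → Walk x y → ℕ
  len {d} = SimpleGraph.len (cayley d)

  Reach : ∀ {d} → ℤ^ d → ℤ^ d → ℕ → Set
  Reach x y n = ∃[ w ] len {x = x} {y} w ≡ n

  len-◅◅ : ∀ {d} {x y z : ℤ^ d} (v : Walk x y) (w : Walk y z) →
           len (v ◅◅ w) ≡ len v + len w
  len-◅◅ ε       w = refl
  len-◅◅ (_ ◅ v) w = cong ℕ.suc (len-◅◅ v w)

  cons : ∀ {d} {xs ys : ℤ^ d} a (w : Walk xs ys) → Reach (a ∷ xs) (a ∷ ys) (len w)
  cons a ε = ε , refl
  cons a ((i , inj₁ refl) ◅ w) with cons a w
  ... | w′ , eq = (suc i , inj₁ refl) ◅ w′ , cong ℕ.suc eq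
  cons a ((i , inj₂ refl) ◅ w) with cons a w
  ... | w′ , eq = (suc i , inj₂ refl) ◅ w′ , cong ℕ.suc eq

  up : ∀ {d} (xs : ℤ^ d) n a → Reach (a ∷ xs) ((+ n ℤ.+ a) ∷ xs) n
  up xs 0         a rewrite ℤ.+-identityˡ a = ε , refl
  up xs (ℕ.suc n) a with up xs n (ℤ.suc a)
  ... | w , eq = subst (λ b → Reach (a ∷ xs) (b ∷ xs) (ℕ.suc n))
                   (shift (+ n) a) ((zero , inj₁ refl) ◅ w , cong ℕ.suc eq)
    where
    shift : ∀ m a → m ℤ.+ (ℤ.1ℤ ℤ.+ a) ≡ (ℤ.1ℤ ℤ.+ m) ℤ.+ a
    shift = solve-∀

  down : ∀ {d} (xs : ℤ^ d) n a → Reach (a ∷ xs) ((ℤ.- (+ n) ℤ.+ a) ∷ xs) n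
  down xs 0         a rewrite ℤ.+-identityˡ a = ε , refl
  down xs (ℕ.suc n) a with down xs n (ℤ.pred a)
  ... | w , eq = subst (λ b → Reach (a ∷ xs) (b ∷ xs) (ℕ.suc n))
                   (shift (+ n) a) ((zero , inj₂ refl) ◅ w , cong ℕ.suc eq)
    where
    shift : ∀ m a → ℤ.- m ℤ.+ (ℤ.-1ℤ ℤ.+ a) ≡ ℤ.- (ℤ.1ℤ ℤ.+ m) ℤ.+ a
    shift = solve-∀

  move : ∀ {d} (xs : ℤ^ d) z a → Reach (a ∷ xs) ((z ℤ.+ a) ∷ xs) ℤ.∣ z ∣
  move xs (+ n)    a = up xs n a
  move xs -[1+ n ] a = down xs (ℕ.suc n) a

  cancel : ∀ a b → (b ℤ.- a) ℤ.+ a ≡ b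
  cancel = solve-∀

  reach : ∀ {d} (x y : ℤ^ d) → Reach x y (ℓ₁ x y)
  reach []       []       = ε , refl
  reach (a ∷ xs) (b ∷ ys) = v ◅◅ w′ ,
    trans (len-◅◅ v w′)
      (cong₂ _+_ (trans v≡ (ℤ.∣i-j∣≡∣j-i∣ b a)) (trans w′≡ (proj₂ (reach xs ys))))
    where
    first = subst (λ c → Reach (a ∷ xs) (c ∷ xs) ℤ.∣ b ℤ.- a ∣) (cancel a b) (move xs (b ℤ.- a) a)
    v = proj₁ first
    v≡ = proj₂ first
    rest = cons b (proj₁ (reach xs ys))
    w′ = proj₁ rest
    w′≡ = proj₂ rest

  ∣·∣-step : ∀ e a → ℤ.∣ e ∣ ≤ 1 → ∀ b → ℤ.∣ a ℤ.- b ∣ ≤ 1 + ℤ.∣ (e ℤ.+ a) ℤ.- b ∣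
  ∣·∣-step e a ∣e∣≤1 b = subst (λ z → ℤ.∣ z ∣ ≤ 1 + ℤ.∣ (e ℤ.+ a) ℤ.- b ∣) (eq e a b)
    (≤-trans (ℤ.∣i+j∣≤∣i∣+∣j∣ (ℤ.- e) _)
      (+-monoˡ-≤ _ (≤-trans (≤-reflexive (ℤ.∣-i∣≡∣i∣ e)) ∣e∣≤1)))
    where
    eq : ∀ e a b → ℤ.- e ℤ.+ ((e ℤ.+ a) ℤ.- b) ≡ a ℤ.- b
    eq = solve-∀

  step : ∀ {d} {x y : ℤ^ d} → Adjacent x y → ∀ z → ℓ₁ x z ≤ 1 + ℓ₁ y z
  step {x = a ∷ xs} (zero , inj₁ refl) (b ∷ zs) = +-monoˡ-≤ _ (∣·∣-step ℤ.1ℤ a (≤-reflexive refl) b)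
  step {x = a ∷ xs} (zero , inj₂ refl) (b ∷ zs) = +-monoˡ-≤ _ (∣·∣-step ℤ.-1ℤ a (≤-reflexive refl) b)
  step {x = a ∷ xs} (suc i , inj₁ refl) (b ∷ zs) =
    ≤-trans (+-monoʳ-≤ ℤ.∣ a ℤ.- b ∣ (step {x = xs} (i , inj₁ refl) zs)) (≤-reflexive (+-suc _ _))
  step {x = a ∷ xs} (suc i , inj₂ refl) (b ∷ zs) =
    ≤-trans (+-monoʳ-≤ ℤ.∣ a ℤ.- b ∣ (step {x = xs} (i , inj₂ refl) zs)) (≤-reflexive (+-suc _ _))

  refl≤ : ∀ {d} (x : ℤ^ d) → ℓ₁ x x ≤ 0
  refl≤ []       = z≤n
  refl≤ (a ∷ xs) rewrite ℤ.+-inverseʳ a = refl≤ xs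

  lower : ∀ {d} {x y : ℤ^ d} (w : Walk x y) → ℓ₁ x y ≤ len w
  lower {x = x} ε       = refl≤ x
  lower {y = y} (s ◅ w) = ≤-trans (step s y) (+-monoʳ-≤ 1 (lower w))

Lipschitz : ∀ {a b} {X : Set a} {Y : Set b} →
            ℕ → (X → X → ℕ) → (Y → Y → ℕ) → (X → Y) → Set a
Lipschitz t δX δY f = ∀ x x′ → δY (f x) (f x′) ≤ t * δX x x′

-- A map on A is a function on pairs (x , proof of x ∈ A).  The Lipschitz
-- condition makes it independent of the proof, since ℓ₁ x x is 0.
LipschitzExtension : ℕ → ℕ → {V : Set ℓ} → (V → V → ℕ) → Set (Level.suc ℓ)
LipschitzExtension {ℓ} d t {V} δ =
  (A : Pred (ℤ^ d) ℓ) (f : Σ (ℤ^ d) A → V) → Lipschitz t (ℓ₁ on proj₁) δ f →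
  ∃[ g ] Lipschitz t ℓ₁ δ g × (∀ a → g (proj₁ a) ≡ f a)

Ball : {V : Set ℓ} → (V → V → ℕ) → V → ℕ → Pred V 0ℓ
Ball δ v r w = δ v w ≤ r

HellyForBalls : ℕ → ℕ → {V : Set ℓ} → (V → V → ℕ) → Set ℓ
HellyForBalls n t {V} δ =
  (c : Fin n → V) (r : Fin n → ℕ) → (∀ i → t ∣ r i) →
  (∀ i j → Ball δ (c i) (r i) ≬ Ball δ (c j) (r j)) →
  Satisfiable (⋂ (Fin n) λ i → Ball δ (c i) (r i))

{-# OPTIONS --safe #-}

-- Helly implies extension.  To extend a map to one more point v, first let
-- its domain consist of n points.  If n ≤ 2d, this is the Helly property.  If
-- n > 2d, some point a is neither the chosen maximiser nor the chosen minimiser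
-- of any coordinate.  Then v is reached from a by changing one coordinate at a
-- time, and the extension is carried along: passing from w to v in coordinate i,
-- there is a second point b of the domain with bᵢ on the far side of aᵢ, so w
-- lies between v and a and between v and b.  The two constraints at a and b
-- thus follow from the single one at w, which leaves n - 1 constraints on v.
-- An infinite domain reduces to a finite one by Dickson's lemma: it has a
-- finite subset L such that between v and any of its points lies a point of L.
-- Boxes of increasing size then exhaust ℤᵈ.
--
-- Extension implies Helly.  Give the centre of the i-th ball, of radius t kᵢ, as
-- the value at the point at distance kᵢ from 0 on the i-th of the 2d half-axes;
-- the value of an extension at 0 lies in every ball.
module Submission where

open import Defs
open import Axiom.ExcludedMiddle using (ExcludedMiddle)
open import Data.Nat.Base using (ℕ; _*_; _≤_)
open import Function.Bundles using (_⇔_)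

open import Data.Fin.Base using (Fin; zero; suc; punchIn; punchOut; remQuot; combine; splitAt; _↑ˡ_)
import Data.Fin.Properties as Fin
open import Data.Integer.Base as ℤ using (ℤ; +_; -[1+_]; 0ℤ)
import Data.Integer.Properties as ℤ
open import Data.Integer.Tactic.RingSolver using (solve-∀)
open import Data.List.Base as List using (List; []; _∷_; _++_; concatMap; upTo; allFin; cartesianProductWith)
import Data.List.Extrema as Extrema
open import Data.List.Membership.Propositional using (_∈_; lose)
open import Data.List.Membership.Propositional.Properties
  using (∈-map⁺; ∈-++⁺ˡ; ∈-++⁺ʳ; ∈-concatMap⁺; ∈-upTo⁺; ∈-allFin; ∈-cartesianProductWith⁺)
import Data.List.Relation.Unary.All as All
open import Data.List.Relation.Unary.Any as Any using (here; there)
open import Data.List.Relation.Unary.Any.Properties using (lookup-index)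
open import Data.Maybe.Base using (Maybe; just; nothing; maybe′)
open import Data.Nat.Base using (_+_; _<_; _≤′_; ≤′-refl; ≤′-step; z≤n; s≤s)
open import Data.Nat.Divisibility using (_∣_; m∣m*n; quotient)
open import Data.Nat.Properties as ℕ
  using (≤-refl; ≤-trans; ≤-reflexive; ≤⇒≤′; +-mono-≤; +-monoˡ-≤;
         *-monoʳ-≤; *-distribˡ-+; *-zeroʳ; *-comm; +-comm)
open import Data.Product.Base using (Σ; ∃-syntax; ∃; _×_; _,_; proj₁; proj₂; uncurry)
open import Data.Sum.Base using (_⊎_; inj₁; inj₂; [_,_]′)
open import Data.Vec.Base using (Vec; []; _∷_; lookup; _[_]≔_; replicate; head; tail)
open import Function.Base using (_∘_; _on_; id; flip)
open import Function.Bundles using (mk⇔)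
open import Level using (Level; 0ℓ; Lift; lift)
open import Relation.Binary.Core using (Rel)
open import Relation.Binary.Construct.Closure.ReflexiveTransitive using (ε; _◅_; _◅◅_)
open import Relation.Binary.Definitions using (Total)
open import Relation.Binary.PropositionalEquality
  using (_≡_; _≢_; refl; sym; trans; cong; cong₂; subst; subst₂; module ≡-Reasoning)
open import Relation.Nullary.Decidable.Core using (yes; no)
open import Relation.Nullary.Negation.Core using (contradiction)
open import Relation.Unary using (Pred; _≬_)

private
  variable
    ℓ : Level
    d : ℕ

-- Path metrics of graphs

module PathMetric (G : SimpleGraph ℓ) {δ : Vertex G → Vertex G → ℕ} (isPathMetric : IsPathMetric G δ) where
  open SimpleGraph G using (Walk; len; ~-sym)

  len-◅◅ : ∀ {u v w} (p : Walk u v) (q : Walk v w) → len (p ◅◅ q) ≡ len p + len q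
  len-◅◅ ε       q = refl
  len-◅◅ (_ ◅ p) q = cong ℕ.suc (len-◅◅ p q)

  reverse : ∀ {u v} (p : Walk u v) → ∃[ q ] len {v} {u} q ≡ len p
  reverse ε       = ε , refl
  reverse (s ◅ p) with reverse p
  ... | q , eq = q ◅◅ (~-sym s ◅ ε) ,
    trans (len-◅◅ q (~-sym s ◅ ε)) (trans (+-comm (len q) 1) (cong ℕ.suc eq))

  split : ∀ {u v} (p : Walk u v) a b → len p ≤ a + b →
          ∃[ w ] (∃[ q ] len {u} {w} q ≤ a) × (∃[ r ] len {w} {v} r ≤ b)
  split p       0         b p≤b = _ , (ε , z≤n) , (p , p≤b)
  split ε       (ℕ.suc a) b _   = _ , (ε , z≤n) , (ε , z≤n)
  split (s ◅ p) (ℕ.suc a) b (s≤s p≤) with split p a b p≤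
  ... | w , (q , q≤) , r = w , (s ◅ q , s≤s q≤) , r

  δ-refl : ∀ u → δ u u ≤ 0
  δ-refl u = proj₂ (isPathMetric u u) ε

  δ≤0⇒≡ : ∀ {u v} → δ u v ≤ 0 → u ≡ v
  δ≤0⇒≡ {u} {v} δ≤0 with proj₁ (isPathMetric u v)
  ... | ε     , _  = refl
  ... | _ ◅ p , eq with () ← ≤-trans (≤-reflexive eq) δ≤0

  δ-sym : ∀ u v → δ u v ≤ δ v u
  δ-sym u v with proj₁ (isPathMetric v u)
  ... | p , p≡ with reverse p
  ...   | q , q≡ = ≤-trans (proj₂ (isPathMetric u v) q) (≤-reflexive (trans q≡ p≡))

  δ-triangle : ∀ u v w → δ u w ≤ δ u v + δ v w
  δ-triangle u v w with proj₁ (isPathMetric u v) | proj₁ (isPathMetric v w)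
  ... | p , p≡ | q , q≡ =
    ≤-trans (proj₂ (isPathMetric u w) (p ◅◅ q)) (≤-reflexive (trans (len-◅◅ p q) (cong₂ _+_ p≡ q≡)))

  -- Cut a shortest walk from `u` to `v` after `a` steps, or at its end if that comes first: the cut
  -- point lies in both balls. A metric that does not come from walks need not have such a point.
  balls-meet : ∀ {u v} a b → δ u v ≤ a + b → Ball δ u a ≬ Ball δ v b
  balls-meet {u} {v} a b δ≤ with proj₁ (isPathMetric u v)
  ... | p , p≡ with split p a b (≤-trans (≤-reflexive p≡) δ≤)
  ...   | w , (q , q≤) , (r , r≤) =
    w , ≤-trans (proj₂ (isPathMetric u w) q) q≤
      , ≤-trans (δ-sym v w) (≤-trans (proj₂ (isPathMetric w v) r) r≤)

module ℓ₁ {d} = PathMetric (cayley d) (ℓ₁-isPathMetric d)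

-- Betweenness in the ℓ₁ metric

Between : ℤ^ d → ℤ^ d → ℤ^ d → Set
Between v w x = ℓ₁ v w + ℓ₁ w x ≤ ℓ₁ v x

Betweenℤ : ℤ → ℤ → ℤ → Set
Betweenℤ x y z = ℤ.∣ x ℤ.- y ∣ + ℤ.∣ y ℤ.- z ∣ ≤ ℤ.∣ x ℤ.- z ∣

Between-∷ : ∀ {x y z} {v w u : ℤ^ d} → Betweenℤ x y z → Between v w u → Between (x ∷ v) (y ∷ w) (z ∷ u)
Between-∷ {x = x} {y} {z} {v} {w} {u} b bs =
  ≤-trans (≤-reflexive (interchange ℤ.∣ x ℤ.- y ∣ (ℓ₁ v w) ℤ.∣ y ℤ.- z ∣ (ℓ₁ w u))) (+-mono-≤ b bs)
  where open import Algebra.Properties.CommutativeSemigroup ℕ.+-commutativeSemigroup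

≤-Betweenℤ : ∀ {x y z} → x ℤ.≤ y → y ℤ.≤ z → Betweenℤ x y z
≤-Betweenℤ {x} {y} {z} x≤y y≤z = ≤-reflexive (ℤ.+-injective (begin
  + (ℤ.∣ x ℤ.- y ∣ + ℤ.∣ y ℤ.- z ∣)         ≡⟨ cong₂ ℤ._+_ (ℤ.∣-∣-≤ x≤y) (ℤ.∣-∣-≤ y≤z) ⟩
  (y ℤ.- x) ℤ.+ (z ℤ.- y)                   ≡⟨ telescope x y z ⟩
  z ℤ.- x                                   ≡⟨ ℤ.∣-∣-≤ (ℤ.≤-trans x≤y y≤z) ⟨
  + ℤ.∣ x ℤ.- z ∣                           ∎))
  where
  open ≡-Reasoning
  telescope : ∀ x y z → (y ℤ.- x) ℤ.+ (z ℤ.- y) ≡ z ℤ.- x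
  telescope = solve-∀

≥-Betweenℤ : ∀ {x y z} → x ℤ.≥ y → y ℤ.≥ z → Betweenℤ x y z
≥-Betweenℤ {x} {y} {z} x≥y y≥z = subst₂ _≤_
  (trans (+-comm ℤ.∣ z ℤ.- y ∣ _) (cong₂ _+_ (ℤ.∣i-j∣≡∣j-i∣ y x) (ℤ.∣i-j∣≡∣j-i∣ z y)))
  (ℤ.∣i-j∣≡∣j-i∣ z x)
  (≤-Betweenℤ y≥z x≥y)

Betweenℤ-reflˡ : ∀ x y → Betweenℤ x x y
Betweenℤ-reflˡ x y rewrite ℤ.+-inverseʳ x = ≤-refl

Betweenℤ-reflʳ : ∀ x y → Betweenℤ x y y
Betweenℤ-reflʳ x y rewrite ℤ.+-inverseʳ y | ℕ.+-identityʳ ℤ.∣ x ℤ.- y ∣ = ≤-refl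

Between-[]≔ : ∀ (v x : ℤ^ d) i {c} → Betweenℤ (lookup v i) c (lookup x i) → Between v (v [ i ]≔ c) x
Between-[]≔ (a ∷ v) (b ∷ x) zero {c} btw = Between-∷ {x = a} {c} {b} {v} {v} {x} btw (+-monoˡ-≤ (ℓ₁ v x) (ℓ₁.δ-refl v))
Between-[]≔ (a ∷ v) (b ∷ x) (suc i) {c} btw =
  Between-∷ {x = a} {a} {b} {v} {v [ i ]≔ c} {x} (Betweenℤ-reflˡ a b) (Between-[]≔ v x i btw)

-- Finite boxes in ℤᵈ

interval : ℕ → List ℤ
interval n = List.map +_ (upTo (ℕ.suc n)) ++ List.map (λ k → ℤ.- (+ k)) (upTo (ℕ.suc n))

∈-interval : ∀ {n} z → ℤ.∣ z ∣ ≤ n → z ∈ interval n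
∈-interval (+ k)        k≤n = ∈-++⁺ˡ (∈-map⁺ _ (∈-upTo⁺ (s≤s k≤n)))
∈-interval {n} -[1+ k ] k<n = ∈-++⁺ʳ (List.map +_ (upTo (ℕ.suc n))) (∈-map⁺ (λ k → ℤ.- (+ k)) (∈-upTo⁺ (s≤s k<n)))

origin : ℤ^ d
origin = replicate _ 0ℤ

box : ∀ d → ℕ → List (ℤ^ d)
box 0         n = [] ∷ []
box (ℕ.suc d) n = cartesianProductWith _∷_ (interval n) (box d n)

∈-box : ∀ {n} (v : ℤ^ d) → ℓ₁ v origin ≤ n → v ∈ box d n
∈-box []      _  = here refl
∈-box (x ∷ v) v≤ = ∈-cartesianProductWith⁺ _∷_
  (∈-interval x (≤-trans (≤-reflexive (cong ℤ.∣_∣ (sym (ℤ.+-identityʳ x)))) (ℕ.m+n≤o⇒m≤o _ v≤)))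
  (∈-box v (ℕ.m+n≤o⇒n≤o _ v≤))

bounded : ∀ {a} {A : Set a} (f : A → ℕ) (xs : List A) → ∃[ N ] ∀ {x} → x ∈ xs → f x ≤ N
bounded f xs = max 0 (List.map f xs) , λ x∈xs → All.lookup (xs≤max 0 _) (∈-map⁺ f x∈xs)
  where open import Data.List.Extrema.Nat using (max; xs≤max)

-- Finite screens

Screens : {I : Set ℓ} → (I → ℤ^ d) → ℤ^ d → List I → Set ℓ
Screens p v L = ∀ i → ∃[ j ] j ∈ L × Between v (p j) (p i)

module _ (em : ExcludedMiddle ℓ) where

  -- All index types are allowed because the induction on `d` passes to subfamilies: the slices and
  -- the two half-spaces.
  Screenable : ℕ → Set (Level.suc ℓ)
  Screenable d = ∀ {I : Set ℓ} (p : I → ℤ^ d) v → ∃ (Screens p v)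

  -- The order is a parameter so that one argument serves the half-spaces above and below `x`.
  module _ {d} (screen : Screenable d) {_≼_ : Rel ℤ 0ℓ} (≼-total : Total _≼_)
           (≼-Betweenℤ : ∀ {x y z} → x ≼ y → y ≼ z → Betweenℤ x y z) where

    -- A point that a screen L of the tails fails to cover is nearer to x in its
    -- head than some member of L, so it lies in one of finitely many slices.
    screenRay : ∀ {I : Set ℓ} (p : I → ℤ^ (ℕ.suc d)) x v → (∀ i → x ≼ head (p i)) →
                ∃ (Screens p (x ∷ v))
    screenRay {I} p x v x≼p = L ++ concatMap slice (interval N) , screens
      where
      dist₀ : I → ℕ
      dist₀ i = ℤ.∣ head (p i) ℤ.- x ∣

      L : List I
      L = proj₁ (screen (tail ∘ p) v)

      N = proj₁ (bounded dist₀ L)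

      level : ℤ → Set ℓ
      level z = Σ I λ i → head (p i) ℤ.- x ≡ z

      sliceScreen : ∀ z → ∃ (Screens {I = level z} (tail ∘ p ∘ proj₁) v)
      sliceScreen z = screen _ v

      slice : ℤ → List I
      slice z = List.map proj₁ (proj₁ (sliceScreen z))

      combined : ∀ {i j} → Betweenℤ x (head (p j)) (head (p i)) → Between v (tail (p j)) (tail (p i)) →
                 Between (x ∷ v) (p j) (p i)
      combined {i} {j} b bs with p j | p i
      ... | y ∷ w | z ∷ u = Between-∷ {x = x} {y} {z} {v} {w} {u} b bs

      screens : Screens p (x ∷ v) (L ++ concatMap slice (interval N))
      screens i with proj₂ (screen (tail ∘ p) v) i
      ... | j , j∈L , btw with ≼-total (head (p j)) (head (p i))
      ...   | inj₁ pj≼pi = j , ∈-++⁺ˡ j∈L , combined (≼-Betweenℤ (x≼p j) pj≼pi) btw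
      -- Within a slice all heads agree, so a screen of the tails suffices there.
      ...   | inj₂ pi≼pj with proj₂ (sliceScreen (head (p i) ℤ.- x)) (i , refl)
      ...     | (k , pk≡pi) , k∈ , btw′ =
        k , ∈-++⁺ʳ L (∈-concatMap⁺ slice (lose (∈-interval _ pi≤N) (∈-map⁺ proj₁ k∈)))
          , combined (subst (λ z → Betweenℤ x z (head (p i)))
                            (sym (∙-cancelʳ (ℤ.- x) (head (p k)) (head (p i)) pk≡pi))
                            (Betweenℤ-reflʳ x (head (p i)))) btw′
        where
        open import Algebra.Properties.AbelianGroup ℤ.+-0-abelianGroup using (∙-cancelʳ)
        pi≤N : dist₀ i ≤ N
        pi≤N = ≤-trans (≤-reflexive (ℤ.∣i-j∣≡∣j-i∣ (head (p i)) x))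
          (≤-trans (ℕ.m+n≤o⇒m≤o _ (≼-Betweenℤ (x≼p i) pi≼pj))
          (≤-trans (≤-reflexive (ℤ.∣i-j∣≡∣j-i∣ x (head (p j)))) (proj₂ (bounded dist₀ L) j∈L)))

  -- Dickson's lemma, in each orthant around v.
  screen : ∀ d → Screenable d
  -- In dimension 0 any single index is a screen; excluded middle decides whether there is one.
  screen 0 {I} p [] with em {I}
  ... | yes i = i ∷ [] , λ j → i , here refl , between[] (p i) (p j)
    where
    between[] : ∀ w x → Between [] w x
    between[] [] [] = z≤n
  ... | no ¬i = [] , λ i → contradiction i ¬i
  screen (ℕ.suc d) {I} p (x ∷ v) = List.map proj₁ (proj₁ above) ++ List.map proj₁ (proj₁ below) , screens
    where
    above : ∃ (Screens {I = Σ I λ i → x ℤ.≤ head (p i)} (p ∘ proj₁) (x ∷ v))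
    above = screenRay (screen d) ℤ.≤-total ≤-Betweenℤ (p ∘ proj₁) x v proj₂

    below : ∃ (Screens {I = Σ I λ i → x ℤ.≥ head (p i)} (p ∘ proj₁) (x ∷ v))
    below = screenRay (screen d) (flip ℤ.≤-total) ≥-Betweenℤ (p ∘ proj₁) x v proj₂

    screens : Screens p (x ∷ v) (List.map proj₁ (proj₁ above) ++ List.map proj₁ (proj₁ below))
    screens i with ℤ.≤-total x (head (p i))
    ... | inj₁ x≤pi with proj₂ above (i , x≤pi)
    ...   | (j , _) , j∈ , btw = j , ∈-++⁺ˡ (∈-map⁺ proj₁ j∈) , btw
    screens i | inj₂ pi≤x with proj₂ below (i , pi≤x)
    ...   | (j , _) , j∈ , btw = j , ∈-++⁺ʳ (List.map proj₁ (proj₁ above)) (∈-map⁺ proj₁ j∈) , btw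

-- Extreme points of a finite family

missed : ∀ {m n} → m < n → (f : Fin m → Fin n) → ∃[ a ] ∀ i → f i ≢ a
missed {m} {n} m<n f with Fin.¬∀⟶∃¬ n _ (λ a → Fin.any? λ i → f i Fin.≟ a)
  -- If every value were hit, a choice of preimages would inject `Fin n` into the smaller `Fin m`.
  (λ hit → Fin.<⇒notInjective {f = proj₁ ∘ hit} m<n
     λ {a} {b} eq → trans (sym (proj₂ (hit a))) (trans (cong f eq) (proj₂ (hit b))))
... | a , ¬hit = a , λ i fi≡a → ¬hit (i , fi≡a)

-- The maximisers and minimisers take up at most `2 * d` indices, so some `a` is none of them. Then
-- `b` is the maximiser if `x` is at most the coordinate of `a`, and the minimiser if it is at least
-- that. Ties do no harm, since only the indices must differ.
surrounded : ∀ {n} → 2 * d < ℕ.suc n → (p : Fin (ℕ.suc n) → ℤ^ d) →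
  ∃[ a ] ∀ i x → ∃[ b ] b ≢ a × Betweenℤ x (lookup (p a) i) (lookup (p b) i)
surrounded {d} {n} 2d<n p = a , λ i x → other i x (ℤ.≤-total x (lookup (p a) i))
  where
  open Extrema ℤ.≤-totalOrder using (argmax; argmin; f[xs]≤f[argmax]; f[argmin]≤f[xs])

  coord : Fin d → Fin (ℕ.suc n) → ℤ
  coord i b = lookup (p b) i

  extreme : Fin 2 → Fin d → Fin (ℕ.suc n)
  extreme zero    i = argmax (coord i) zero (allFin _)
  extreme (suc _) i = argmin (coord i) zero (allFin _)

  a = proj₁ (missed 2d<n (uncurry extreme ∘ remQuot {2} d))

  extreme≢a : ∀ s i → extreme s i ≢ a
  extreme≢a s i = subst (λ c → uncurry extreme c ≢ a) (Fin.remQuot-combine s i)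
    (proj₂ (missed 2d<n (uncurry extreme ∘ remQuot {2} d)) (combine s i))

  other : ∀ i x → x ℤ.≤ coord i a ⊎ coord i a ℤ.≤ x →
          ∃[ b ] b ≢ a × Betweenℤ x (coord i a) (coord i b)
  other i x (inj₁ x≤a) = extreme zero i , extreme≢a zero i ,
    ≤-Betweenℤ x≤a (All.lookup (f[xs]≤f[argmax] {f = coord i} zero (allFin _)) (∈-allFin a))
  other i x (inj₂ a≤x) = extreme (suc zero) i , extreme≢a (suc zero) i ,
    ≥-Betweenℤ a≤x (All.lookup (f[argmin]≤f[xs] {f = coord i} zero (allFin _)) (∈-allFin a))

-- Replacing the entries of `v` by those of `u` one at a time, from the front, ends at `u`; the
-- hypothesis carries `P` back along this path.
coordinatewise : ∀ {a p n} {A : Set a} {P : Pred (Vec A n) p} (u : Vec A n) → P u →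
  (∀ v i → P (v [ i ]≔ lookup u i) → P v) → ∀ v → P v
coordinatewise []      Pu step []      = Pu
coordinatewise {P = P} (x ∷ u) Pu step (y ∷ v) = step (y ∷ v) zero
  (coordinatewise {P = λ w → P (x ∷ w)} u Pu (λ w i → step (x ∷ w) (suc i)) v)

-- Extension to one more point

module Extend (em : ExcludedMiddle ℓ) (H : SimpleGraph ℓ) {δ : Vertex H → Vertex H → ℕ}
              (isPathMetric : IsPathMetric H δ) (base : Vertex H)
              (d t : ℕ) (helly : HellyForBalls (2 * d) t δ) where

  open PathMetric H isPathMetric

  Compatible : ∀ {i} {I : Set i} → (I → ℤ^ d) → (I → Vertex H) → ℤ^ d → Vertex H → Set i
  Compatible p q v y = ∀ i → δ y (q i) ≤ t * ℓ₁ v (p i)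

  -- Along a point in between, the two bounds add up without loss, so a constraint at `w` makes the
  -- one at `x` redundant.
  relay : ∀ (v w x : ℤ^ d) {y z u} → δ y z ≤ t * ℓ₁ v w → δ z u ≤ t * ℓ₁ w x → Between v w x →
          δ y u ≤ t * ℓ₁ v x
  relay v w x {y} {z} {u} yz zu vwx = begin
    δ y u                       ≤⟨ δ-triangle y z u ⟩
    δ y z + δ z u               ≤⟨ +-mono-≤ yz zu ⟩
    t * ℓ₁ v w + t * ℓ₁ w x     ≡⟨ *-distribˡ-+ t (ℓ₁ v w) (ℓ₁ w x) ⟨
    t * (ℓ₁ v w + ℓ₁ w x)       ≤⟨ *-monoʳ-≤ t vwx ⟩
    t * ℓ₁ v x                  ∎
    where open ℕ.≤-Reasoning

  adjoin : ∀ {i} {I : Set i} {p : I → ℤ^ d} {q : I → Vertex H} {v y} →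
           Lipschitz t (ℓ₁ on p) δ q → Compatible p q v y →
           Lipschitz t (ℓ₁ on maybe′ p v) δ (maybe′ q y)
  adjoin                 lip c (just i) (just j) = lip i j
  adjoin                 lip c nothing  (just j) = c j
  adjoin {p = p} {v = v} lip c (just i) nothing  =
    ≤-trans (δ-sym _ _) (≤-trans (c i) (*-monoʳ-≤ t (ℓ₁.δ-sym v (p i))))
  adjoin         {y = y} lip c nothing  nothing  = ≤-trans (δ-refl y) z≤n

  -- Induction on the excess `k` over the number of balls in the Helly property.
  extendFin : ∀ k (p : Fin (k + 2 * d) → ℤ^ d) (q : Fin (k + 2 * d) → Vertex H) →
              Lipschitz t (ℓ₁ on p) δ q → ∀ v → ∃ (Compatible p q v)
  extendFin 0 p q lip v = proj₁ common , λ i → ≤-trans (δ-sym _ _) (proj₂ common i)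
    where
    -- The admissible values form the intersection of these balls. The triangle inequality through
    -- `v` makes them meet in pairs.
    common = helly q (λ i → t * ℓ₁ v (p i)) (λ i → m∣m*n (ℓ₁ v (p i))) λ i j →
      balls-meet _ _ (begin
        δ (q i) (q j)                         ≤⟨ lip i j ⟩
        t * ℓ₁ (p i) (p j)                    ≤⟨ *-monoʳ-≤ t (ℓ₁.δ-triangle (p i) v (p j)) ⟩
        t * (ℓ₁ (p i) v + ℓ₁ v (p j))         ≤⟨ *-monoʳ-≤ t (+-monoˡ-≤ _ (ℓ₁.δ-sym (p i) v)) ⟩
        t * (ℓ₁ v (p i) + ℓ₁ v (p j))         ≡⟨ *-distribˡ-+ t (ℓ₁ v (p i)) (ℓ₁ v (p j)) ⟩
        t * ℓ₁ v (p i) + t * ℓ₁ v (p j)       ∎)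
      where open ℕ.≤-Reasoning
  extendFin (ℕ.suc k) p q lip with surrounded (s≤s (ℕ.m≤n+m (2 * d) k)) p
  -- The path to `v` starts at `p a`, where `q a` itself is admissible.
  ... | a , around = coordinatewise {P = λ v → ∃ (Compatible p q v)} (p a) (q a , lip a) step
    where
    step : ∀ v i → ∃ (Compatible p q (v [ i ]≔ lookup (p a) i)) → ∃ (Compatible p q v)
    step v i (z , z-ok) with around i (lookup v i)
    ... | b , b≢a , vab = y , y-ok
      where
      w = v [ i ]≔ lookup (p a) i

      -- `punchIn` omits `a`, and the new point `w` with value `z`, coded as `nothing`, takes the
      -- place of `b`. One index fewer remains.
      replace : Fin (k + 2 * d) → Maybe (Fin (ℕ.suc k + 2 * d))
      replace c with punchIn a c Fin.≟ b
      ... | yes _ = nothing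
      ... | no  _ = just (punchIn a c)

      replace≡nothing : ∃[ c ] replace c ≡ nothing
      replace≡nothing = punchOut (b≢a ∘ sym) , hit
        where
        hit : replace (punchOut (b≢a ∘ sym)) ≡ nothing
        hit with punchIn a (punchOut (b≢a ∘ sym)) Fin.≟ b
        ... | yes _  = refl
        ... | no  ≢b = contradiction (Fin.punchIn-punchOut (b≢a ∘ sym)) ≢b

      replace≡just : ∀ {j} → a ≢ j → j ≢ b → ∃[ c ] replace c ≡ just j
      replace≡just {j} a≢j j≢b = punchOut a≢j , hit
        where
        hit : replace (punchOut a≢j) ≡ just j
        hit with punchIn a (punchOut a≢j) Fin.≟ b
        ... | yes ≡b = contradiction (trans (sym (Fin.punchIn-punchOut a≢j)) ≡b) j≢b
        ... | no  _  = cong just (Fin.punchIn-punchOut a≢j)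

      extended = extendFin k (maybe′ p w ∘ replace) (maybe′ q z ∘ replace)
        (λ c c′ → adjoin {p = p} {v = w} lip z-ok (replace c) (replace c′)) v
      y = proj₁ extended

      kept : ∀ {m} → ∃[ c ] replace c ≡ m → δ y (maybe′ q z m) ≤ t * ℓ₁ v (maybe′ p w m)
      kept (c , refl) = proj₂ extended c

      y-ok : Compatible p q v y
      y-ok j with a Fin.≟ j | j Fin.≟ b
      -- The constraints at `a` and `b` were dropped from the family; both are recovered through
      -- `w`.
      ... | yes refl | _        = relay v w (p a) (kept replace≡nothing) (z-ok a)
                                    (Between-[]≔ v (p a) i (Betweenℤ-reflʳ (lookup v i) _))
      ... | no _     | yes refl = relay v w (p b) (kept replace≡nothing) (z-ok b) (Between-[]≔ v (p b) i vab)
      ... | no a≢j   | no j≢b   = kept (replace≡just a≢j j≢b)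

  extendPoint : {I : Set ℓ} (p : I → ℤ^ d) (q : I → Vertex H) →
                Lipschitz t (ℓ₁ on p) δ q → ∀ v → ∃ (Compatible p q v)
  extendPoint {I} p q lip v with screen em d p v
  -- An empty screen forces `I` to be empty, so any vertex will do.
  ... | []      , screens = base , λ i → contradiction (proj₁ (proj₂ (screens i))) λ ()
  ... | (o ∷ L) , screens = y , λ i → through (screens i)
    where
    n = ℕ.suc (List.length L)

    -- Padding with `2 * d` copies of `o` gives the family the size that `extendFin` expects.
    pick : Fin (n + 2 * d) → I
    pick = [ List.lookup (o ∷ L) , (λ _ → o) ]′ ∘ splitAt n

    extended = extendFin n (p ∘ pick) (q ∘ pick) (λ a b → lip (pick a) (pick b)) v
    y = proj₁ extended

    on-list : ∀ {j} → j ∈ o ∷ L → δ y (q j) ≤ t * ℓ₁ v (p j)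
    on-list j∈ = subst (λ j → δ y (q j) ≤ t * ℓ₁ v (p j))
      (trans (cong [ List.lookup (o ∷ L) , (λ _ → o) ]′ (Fin.splitAt-↑ˡ n (Any.index j∈) (2 * d)))
             (sym (lookup-index j∈)))
      (proj₂ extended (Any.index j∈ ↑ˡ 2 * d))

    through : ∀ {i} → ∃[ j ] j ∈ o ∷ L × Between v (p j) (p i) → δ y (q i) ≤ t * ℓ₁ v (p i)
    through {i} (j , j∈ , btw) = relay v (p j) (p i) (on-list j∈) (lip j i) btw

  -- Partial maps and the exhaustion of ℤᵈ

  record PartialMap : Set (Level.suc ℓ) where
    field
      Index     : Set ℓ
      point     : Index → ℤ^ d
      value     : Index → Vertex H
      lipschitz : Lipschitz t (ℓ₁ on point) δ value

  open PartialMap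

  infix 4 _⊑_

  record _⊑_ (F G : PartialMap) : Set ℓ where
    field
      embed   : Index F → Index G
      point≡  : ∀ i → point G (embed i) ≡ point F i
      value≡  : ∀ i → value G (embed i) ≡ value F i

  open _⊑_

  ⊑-refl : ∀ {F} → F ⊑ F
  ⊑-refl = record { embed = id ; point≡ = λ _ → refl ; value≡ = λ _ → refl }

  ⊑-trans : ∀ {F G K} → F ⊑ G → G ⊑ K → F ⊑ K
  ⊑-trans F⊑G G⊑K = record
    { embed  = embed G⊑K ∘ embed F⊑G
    ; point≡ = λ i → trans (point≡ G⊑K _) (point≡ F⊑G i)
    ; value≡ = λ i → trans (value≡ G⊑K _) (value≡ F⊑G i)
    }

  Defined : PartialMap → ℤ^ d → Set ℓ
  Defined F v = ∃[ i ] point F i ≡ v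

  Defined-⊑ : ∀ {F G v} → F ⊑ G → Defined F v → Defined G v
  Defined-⊑ F⊑G (i , eq) = embed F⊑G i , trans (point≡ F⊑G i) eq

  -- If `v` is already in the domain, the Lipschitz bound at distance 0 forces the new value to
  -- equal the old one.
  insert : PartialMap → ℤ^ d → PartialMap
  insert F v = record
    { point     = maybe′ (point F) v
    ; value     = maybe′ (value F) (proj₁ new)
    ; lipschitz = adjoin {p = point F} {v = v} (lipschitz F) (proj₂ new)
    }
    where new = extendPoint (point F) (value F) (lipschitz F) v

  ⊑-insert : ∀ F v → F ⊑ insert F v
  ⊑-insert F v = record { embed = just ; point≡ = λ _ → refl ; value≡ = λ _ → refl }

  insertAll : PartialMap → List (ℤ^ d) → PartialMap
  insertAll = List.foldl insert

  ⊑-insertAll : ∀ F vs → F ⊑ insertAll F vs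
  ⊑-insertAll F []       = ⊑-refl
  ⊑-insertAll F (v ∷ vs) = ⊑-trans (⊑-insert F v) (⊑-insertAll (insert F v) vs)

  defined-insertAll : ∀ F {v vs} → v ∈ vs → Defined (insertAll F vs) v
  defined-insertAll F {vs = v ∷ vs} (here refl)  = Defined-⊑ (⊑-insertAll (insert F v) vs) (nothing , refl)
  defined-insertAll F {vs = v ∷ vs} (there v∈vs) = defined-insertAll (insert F v) v∈vs

  stage : PartialMap → ℕ → PartialMap
  stage F 0         = F
  stage F (ℕ.suc n) = insertAll (stage F n) (box d n)

  stage-mono : ∀ F {m n} → m ≤′ n → stage F m ⊑ stage F n
  stage-mono F ≤′-refl            = ⊑-refl
  stage-mono F (≤′-step {n} m≤′n) = ⊑-trans (stage-mono F m≤′n) (⊑-insertAll (stage F n) (box d n))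

  -- Both stages embed in stage `m + n`, which is a single Lipschitz map.
  stage-lipschitz : ∀ F m n (i : Index (stage F m)) (j : Index (stage F n)) →
    δ (value (stage F m) i) (value (stage F n) j) ≤ t * ℓ₁ (point (stage F m) i) (point (stage F n) j)
  stage-lipschitz F m n i j = subst₂ _≤_
    (cong₂ δ (value≡ Fₘ⊑ i) (value≡ Fₙ⊑ j))
    (cong (t *_) (cong₂ ℓ₁ (point≡ Fₘ⊑ i) (point≡ Fₙ⊑ j)))
    (lipschitz (stage F (m + n)) (embed Fₘ⊑ i) (embed Fₙ⊑ j))
    where
    Fₘ⊑ = stage-mono F (≤⇒≤′ (ℕ.m≤m+n m n))
    Fₙ⊑ = stage-mono F (≤⇒≤′ (ℕ.m≤n+m n m))

  lipschitzExtension : LipschitzExtension d t δ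
  lipschitzExtension A f lip = g , g-lipschitz , λ a → sym (δ≤0⇒≡ (f-close-g a))
    where
    F : PartialMap
    F = record { point = proj₁ ; value = f ; lipschitz = lip }

    -- The points of `box d n` enter at stage `suc n`, hence the successor.
    time : ℤ^ d → ℕ
    time v = ℕ.suc (ℓ₁ v origin)

    F∞ : ℤ^ d → PartialMap
    F∞ v = stage F (time v)

    defined : ∀ v → Defined (F∞ v) v
    defined v = defined-insertAll (stage F (ℓ₁ v origin)) (∈-box v ≤-refl)

    g : ℤ^ d → Vertex H
    g v = value (F∞ v) (proj₁ (defined v))

    g-lipschitz : Lipschitz t ℓ₁ δ g
    g-lipschitz v w = subst₂ (λ x y → δ (g v) (g w) ≤ t * ℓ₁ x y) (proj₂ (defined v)) (proj₂ (defined w))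
      (stage-lipschitz F (time v) (time w) (proj₁ (defined v)) (proj₁ (defined w)))

    -- Stage 0 is `f`, so this compares two values over the same point.
    f-close-g : ∀ a → δ (f a) (g (proj₁ a)) ≤ 0
    f-close-g a@(v , _) = begin
      δ (f a) (g v)                                     ≤⟨ stage-lipschitz F 0 (time v) a (proj₁ (defined v)) ⟩
      t * ℓ₁ v (point (F∞ v) (proj₁ (defined v)))       ≡⟨ cong (λ w → t * ℓ₁ v w) (proj₂ (defined v)) ⟩
      t * ℓ₁ v v                                        ≤⟨ *-monoʳ-≤ t (ℓ₁.δ-refl v) ⟩
      t * 0                                             ≡⟨ *-zeroʳ t ⟩
      0                                                 ∎
      where open ℕ.≤-Reasoning

-- Points on the half-axes

axis : Fin d → ℤ → ℤ^ d
axis i z = origin [ i ]≔ z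

origin-axis : ∀ (i : Fin d) z → ℓ₁ origin (axis i z) ≤ ℤ.∣ z ∣
origin-axis {ℕ.suc d} zero z = ≤-reflexive (trans
  (cong₂ _+_ (trans (cong ℤ.∣_∣ (ℤ.+-identityˡ (ℤ.- z))) (ℤ.∣-i∣≡∣i∣ z)) (ℕ.n≤0⇒n≡0 (ℓ₁.δ-refl (origin {d}))))
  (ℕ.+-identityʳ _))
origin-axis (suc i) z = origin-axis i z

axis-origin : ∀ (i : Fin d) z → ℤ.∣ z ∣ ≤ ℓ₁ (axis i z) origin
axis-origin zero    z = ≤-trans (≤-reflexive (cong ℤ.∣_∣ (sym (ℤ.+-identityʳ z)))) (ℕ.m≤m+n _ _)
axis-origin (suc i) z = axis-origin i z

same-axis : ∀ (i : Fin d) y z → ℤ.∣ y ℤ.- z ∣ ≤ ℓ₁ (axis i y) (axis i z)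
same-axis zero    y z = ℕ.m≤m+n _ _
same-axis (suc i) y z = same-axis i y z

distinct-axes : ∀ {i j : Fin d} → i ≢ j → ∀ y z → ℤ.∣ y ∣ + ℤ.∣ z ∣ ≤ ℓ₁ (axis i y) (axis j z)
distinct-axes {i = zero}  {zero}  i≢j y z = contradiction refl i≢j
distinct-axes {i = zero}  {suc j} i≢j y z = +-mono-≤ (≤-reflexive (cong ℤ.∣_∣ (sym (ℤ.+-identityʳ y))))
  (≤-trans (axis-origin j z) (ℓ₁.δ-sym (axis j z) origin))
distinct-axes {i = suc i} {zero}  i≢j y z = ≤-trans (≤-reflexive (+-comm ℤ.∣ y ∣ _))
  (+-mono-≤ (≤-reflexive (trans (sym (ℤ.∣-i∣≡∣i∣ z)) (cong ℤ.∣_∣ (sym (ℤ.+-identityˡ (ℤ.- z))))))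
            (axis-origin i y))
distinct-axes {i = suc i} {suc j} i≢j y z = distinct-axes (i≢j ∘ cong suc) y z

signed : Fin 2 → ℕ → ℤ
signed zero    k = + k
signed (suc _) k = ℤ.- (+ k)

∣signed∣ : ∀ s k → ℤ.∣ signed s k ∣ ≡ k
∣signed∣ zero       k = refl
∣signed∣ (suc zero) k = ℤ.∣-i∣≡∣i∣ (+ k)

opposite-signs : ∀ {s s′} → s ≢ s′ → ∀ k l → k + l ≤ ℤ.∣ signed s k ℤ.- signed s′ l ∣
opposite-signs {zero}     {zero}     s≢s′ k l = contradiction refl s≢s′
opposite-signs {zero}     {suc zero} s≢s′ k l = ≤-reflexive (cong (λ z → ℤ.∣ + k ℤ.+ z ∣) (sym (ℤ.neg-involutive (+ l))))
opposite-signs {suc zero} {zero}     s≢s′ k l = ≤-trans (opposite-signs {zero} {suc zero} (λ ()) k l)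
  (≤-reflexive (trans (sym (ℤ.∣-i∣≡∣i∣ (+ k ℤ.- ℤ.- (+ l)))) (cong ℤ.∣_∣ (flip-signs (+ k) (+ l)))))
  where
  flip-signs : ∀ x y → ℤ.- (x ℤ.- ℤ.- y) ≡ ℤ.- x ℤ.- y
  flip-signs = solve-∀
opposite-signs {suc zero} {suc zero} s≢s′ k l = contradiction refl s≢s′

ray : Fin 2 × Fin d → ℕ → ℤ^ d
ray (s , i) k = axis i (signed s k)

-- The origin lies on a geodesic between the two points: distinct axes contribute separate
-- coordinates, and opposite halves of one axis lie on either side of 0.
distinct-rays : ∀ {a b : Fin 2 × Fin d} → a ≢ b → ∀ k l → k + l ≤ ℓ₁ (ray a k) (ray b l)
distinct-rays {a = s , i} {s′ , j} a≢b k l with i Fin.≟ j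
... | no i≢j   = subst (_≤ ℓ₁ (ray (s , i) k) (ray (s′ , j) l))
                   (cong₂ _+_ (∣signed∣ s k) (∣signed∣ s′ l))
                   (distinct-axes i≢j (signed s k) (signed s′ l))
... | yes refl = ≤-trans (opposite-signs (a≢b ∘ cong (_, i)) k l) (same-axis i (signed s k) (signed s′ l))

origin-ray : ∀ (a : Fin 2 × Fin d) k → ℓ₁ origin (ray a k) ≤ k
origin-ray (s , i) k = ≤-trans (origin-axis i (signed s k)) (≤-reflexive (∣signed∣ s k))

remQuot-injective : ∀ {m} n {i j : Fin (m * n)} → remQuot {m} n i ≡ remQuot {m} n j → i ≡ j
remQuot-injective {m} n {i} {j} eq = trans (sym (Fin.combine-remQuot {m} n i))
  (trans (cong (uncurry combine) eq) (Fin.combine-remQuot {m} n j))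

-- Extension implies Helly

module _ (H : SimpleGraph ℓ) {δ : Vertex H → Vertex H → ℕ} (isPathMetric : IsPathMetric H δ) where
  open PathMetric H isPathMetric

  hellyForBalls : ∀ d t → LipschitzExtension d t δ → HellyForBalls (2 * d) t δ
  hellyForBalls d t extension c r t∣r meet = g origin , in-ball
    where
    k : Fin (2 * d) → ℕ
    k i = quotient (t∣r i)

    r≡tk : ∀ i → r i ≡ t * k i
    r≡tk i = trans (_∣_.equality (t∣r i)) (*-comm (k i) t)

    half-axis : Fin (2 * d) → Fin 2 × Fin d
    half-axis = remQuot {2} d

    p : Fin (2 * d) → ℤ^ d
    p i = ray (half-axis i) (k i)

    A : Pred (ℤ^ d) _
    A x = Lift _ (∃[ i ] p i ≡ x)

    -- Indices with `k i` zero share the origin, so the value is read off the index in the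
    -- membership proof; `c-lipschitz` covers every such choice.
    f : Σ (ℤ^ d) A → Vertex H
    f (_ , lift (i , _)) = c i

    c-lipschitz : Lipschitz t (ℓ₁ on p) δ c
    c-lipschitz i j with i Fin.≟ j
    ... | yes refl = ≤-trans (δ-refl (c i)) z≤n
    ... | no i≢j with meet i j
    -- A common point `w` bounds the distance of the centres by the sum of the radii, which is `t`
    -- times the length of the route through the origin.
    ...   | w , cᵢw≤ , cⱼw≤ = begin
      δ (c i) (c j)               ≤⟨ δ-triangle (c i) w (c j) ⟩
      δ (c i) w + δ w (c j)       ≤⟨ +-mono-≤ cᵢw≤ (≤-trans (δ-sym w (c j)) cⱼw≤) ⟩
      r i + r j                   ≡⟨ cong₂ _+_ (r≡tk i) (r≡tk j) ⟩
      t * k i + t * k j           ≡⟨ *-distribˡ-+ t (k i) (k j) ⟨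
      t * (k i + k j)             ≤⟨ *-monoʳ-≤ t (distinct-rays (i≢j ∘ remQuot-injective {2} d) (k i) (k j)) ⟩
      t * ℓ₁ (p i) (p j)          ∎
      where open ℕ.≤-Reasoning

    f-lipschitz : Lipschitz t (ℓ₁ on proj₁) δ f
    f-lipschitz (_ , lift (i , refl)) (_ , lift (j , refl)) = c-lipschitz i j

    extended = extension A f f-lipschitz
    g = proj₁ extended

    in-ball : ∀ i → δ (c i) (g origin) ≤ r i
    in-ball i = begin
      δ (c i) (g origin)          ≤⟨ δ-sym _ _ ⟩
      δ (g origin) (c i)          ≡⟨ cong (δ (g origin)) (proj₂ (proj₂ extended) (p i , lift (i , refl))) ⟨
      δ (g origin) (g (p i))      ≤⟨ proj₁ (proj₂ extended) origin (p i) ⟩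
      t * ℓ₁ origin (p i)         ≤⟨ *-monoʳ-≤ t (origin-ray (half-axis i) (k i)) ⟩
      t * k i                     ≡⟨ r≡tk i ⟨
      r i                         ∎
      where open ℕ.≤-Reasoning

theorem4p3 : ∀ {ℓ} (em : ExcludedMiddle ℓ) (d t : ℕ) → 1 ≤ d → 1 ≤ t →
    (H : SimpleGraph ℓ) → Vertex H → (conn : Connected H) →
    LipschitzExtension d t (dist em H conn) ⇔ HellyForBalls (2 * d) t (dist em H conn)
theorem4p3 em d t _ _ H base conn =
  mk⇔ (hellyForBalls H isPathMetric d t) (Extend.lipschitzExtension em H isPathMetric base d t)
  where isPathMetric = dist-isPathMetric em H conn
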